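{- Let $H\subsetneq\mathbb{N}$ be an Arf numerical semigroup written as $$H=\{h_0=0,h_1,\dots,h_n,\rightarrow\}=\{0,x_1,x_1+x_2,\dots,x_1+\dots+x_n,\rightarrow\}$$ with positive integers $x_1,\dots,x_n$ and $h_j=x_1+\dots+x_j$ for all $j\in\{1,\dots,n\}$. Then $\mathrm{F}(H)+2$ is in the minimal Arf system of generators of $H$ if and only if $x_j\ne x_{j+1}+\dots+x_n+1$ for all $j\in\{1,\dots,n\}$ (for $j=n$ the sum $x_{j+1}+\dots+x_n$ is empty, i.e. $0$).
   Context: $\mathbb{N}$ is the set of non-negative integers. A numerical semigroup is a subset $H\subseteq\mathbb{N}$ that contains $0$, is closed under addition, and has finite complement in $\mathbb{N}$. It is Arf if $2a-b\in H$ for all $a,b\in H$ with $a\ge b$. The Frobenius number $\mathrm{F}(H)$ is the largest element of $\mathbb{N}\setminus H$. The notation $H=\{h_0=0,h_1,\dots,h_n,\rightarrow\}$ means that $h_0<h_1<\dots<h_n$ are the elements of $H$ up to its conductor $h_n=\mathrm{F}(H)+1$, listed increasingly, and that every integer larger than $h_n$ is in $H$; thus $x_j=h_j-h_{j-1}$. (It is known that a set of this form, with $x_j$ positive integers, is an Arf numerical semigroup if and only if $x_j\in\{x_{j+1},x_{j+1}+x_{j+2},\dots,x_{j+1}+\dots+x_n,\rightarrow\}$ for all $j\in\{1,\dots,n\}$, where "$\rightarrow$" means that all larger integers are included.) For $X\subset\mathbb{N}$ with $\gcd(X)=1$, $\langle X\rangle$ is the submonoid of $\mathbb{N}$ generated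 by $X$ and $\mathrm{Arf}(\langle X\rangle)$ (the Arf closure) is the smallest Arf numerical semigroup, with respect to inclusion, containing $\langle X\rangle$. $X$ is an Arf system of generators of $H$ if $\mathrm{Arf}(\langle X\rangle)=H$, and it is minimal if no proper subset of $X$ is an Arf system of generators of $H$. It is known that every Arf numerical semigroup has a unique minimal Arf system of generators. -}

module Defs where

open import Level using (0ℓ)
open import Data.Nat.Base using (ℕ; suc; _+_; _*_; _∸_; _≤_; _<_)
open import Data.Nat.Divisibility using (_∣_)
open import Data.Fin.Base using (Fin; zero; suc; fromℕ)
import Data.List.Membership.Propositional as List
open import Data.Product using (∃-syntax; _×_)
open import Data.Sum using (_⊎_)
open import Data.Vec.Base using (Vec; _∷_; sum)
open import Relation.Binary.PropositionalEquality using (_≡_)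
open import Relation.Nullary using (¬_)
open import Relation.Unary using (Pred; _∈_; _∉_; _⊆_; _⊂_; ∁)

SubsetOfℕ : Set₁
SubsetOfℕ = Pred ℕ 0ℓ

Finite : SubsetOfℕ → Set
Finite P = ∃[ ms ] (P ⊆ λ m → m List.∈ ms)

record IsNumericalSemigroup (H : SubsetOfℕ) : Set where
  field
    0∈               : 0 ∈ H
    +-closed         : ∀ {a b} → a ∈ H → b ∈ H → a + b ∈ H
    finiteComplement : Finite (∁ H)

record IsArfNumericalSemigroup (H : SubsetOfℕ) : Set where
  field
    isNumericalSemigroup : IsNumericalSemigroup H
    -- Truncated subtraction is exact here, since b ≤ a.
    arf : ∀ {a b} → a ∈ H → b ∈ H → b ≤ a → 2 * a ∸ b ∈ H

  open IsNumericalSemigroup isNumericalSemigroup public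

record IsFrobeniusNumber (H : SubsetOfℕ) (F : ℕ) : Set where
  field
    gap     : F ∉ H
    largest : ∀ {m} → m ∉ H → m ≤ F

record IsGCD (X : SubsetOfℕ) (g : ℕ) : Set where
  field
    commonDivisor : ∀ {m} → m ∈ X → g ∣ m
    greatest      : ∀ {d} → (∀ {m} → m ∈ X → d ∣ m) → d ∣ g

data ⟨_⟩ (X : SubsetOfℕ) : SubsetOfℕ where
  gen  : ∀ {m} → m ∈ X → m ∈ ⟨ X ⟩
  unit : 0 ∈ ⟨ X ⟩
  add  : ∀ {a b} → a ∈ ⟨ X ⟩ → b ∈ ⟨ X ⟩ → a + b ∈ ⟨ X ⟩

record IsArfClosure (M H : SubsetOfℕ) : Set₁ where
  field
    isArf    : IsArfNumericalSemigroup H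
    contains : M ⊆ H
    smallest : ∀ (S : SubsetOfℕ) → IsArfNumericalSemigroup S → M ⊆ S → H ⊆ S

record IsArfSystemOfGenerators (X H : SubsetOfℕ) : Set₁ where
  field
    gcd≡1   : IsGCD X 1
    closure : IsArfClosure ⟨ X ⟩ H

record IsMinimalArfSystemOfGenerators (X H : SubsetOfℕ) : Set₁ where
  field
    generates : IsArfSystemOfGenerators X H
    minimal   : ∀ (Y : SubsetOfℕ) → Y ⊂ X → ¬ IsArfSystemOfGenerators Y H

-- h x j = x₁ + ⋯ + xⱼ for 0 ≤ j ≤ n.
h : ∀ {n} → Vec ℕ n → Fin (suc n) → ℕ
h x        zero    = 0
h (x₁ ∷ x) (suc j) = x₁ + h x j

-- The index is 0-based: sumAfter at the position of xⱼ is xⱼ₊₁ + ⋯ + xₙ.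
sumAfter : ∀ {n} → Vec ℕ n → Fin n → ℕ
sumAfter (_ ∷ x) zero    = sum x
sumAfter (_ ∷ x) (suc j) = sumAfter x j

-- The set {0, x₁, x₁ + x₂, …, x₁ + ⋯ + xₙ, →}.
fromDifferences : ∀ {n} → Vec ℕ n → SubsetOfℕ
fromDifferences {n} x m = (∃[ j ] m ≡ h x j) ⊎ h x (fromℕ n) < m

{-# OPTIONS --safe #-}
-- Write c = F(H) + 1 = hₙ, so that F(H) + 2 = c + 1. The condition xⱼ = xⱼ₊₁ + ⋯ + xₙ + 1 says
-- c + 1 = 2hⱼ − hⱼ₋₁.
--
-- If it holds, c + 1 is redundant in X: for an Arf set S ⊇ X ∖ {c + 1}, the set S ∪ [c + 1, ∞) is
-- Arf and contains X, hence H, so hⱼ₋₁ and hⱼ, being at most c, lie in S, and therefore so does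
-- c + 1.
--
-- If it fails for all j, then c + 1 = 2p − q has no solution q < p in H, as induction on n shows
-- (H − x₁ is again Arf, with differences x₂, …, xₙ; the case q = 0 is treated more generally, with
-- p + p′ for 2p, since shifting only one summand gives p ≠ p′). Hence (H ∖ {c + 1}) ∪ (X ∩ {c + 1}) is an
-- Arf semigroup containing X, so it equals H, and c + 1 ∈ X.
module Submission where

open import Data.Empty using (⊥-elim)
open import Data.Nat.Base using (ℕ; zero; suc; _+_; _*_; _∸_; _<_; _≤_; z≤n; s≤s)
open import Data.Nat.Divisibility using (_∣0; ∣m∣n⇒∣m+n; ∣m+n∣m⇒∣n)
open import Data.Nat.Induction using (<-wellFounded)
open import Data.Nat.Properties
open import Data.Nat.Solver using (module +-*-Solver)
open import Data.Fin.Base using (Fin; zero; suc; fromℕ; inject₁)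
open import Data.List.Base using (_∷_; upTo)
import Data.List.Membership.Propositional as List
open import Data.List.Membership.Propositional.Properties using (∈-upTo⁺)
open import Data.List.Relation.Unary.Any using (here; there)
open import Data.Product using (∃-syntax; _×_; _,_; proj₁; proj₂)
open import Data.Sum using (_⊎_; inj₁; inj₂)
open import Data.Vec.Base using (Vec; []; _∷_; lookup; sum)
open import Function.Bundles using (_⇔_; mk⇔)
open import Induction.WellFounded using (Acc; acc)
open import Relation.Binary.PropositionalEquality
  using (_≡_; _≢_; refl; sym; trans; cong; subst; module ≡-Reasoning)
open import Relation.Nullary using (yes; no)
open import Relation.Unary using (_∈_; _⊆_; _⊂_; _≐_; U; ∁)
open import Defs

open +-*-Solver using (solve; _:+_; _:=_; con)

-- Sets closed under `2a − b`

-- The Arf condition 2a − b ∈ P with b = z and a = z + d.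
ArfClosed : SubsetOfℕ → Set
ArfClosed P = ∀ z d → z ∈ P → z + d ∈ P → z + d + d ∈ P

2[z+d]∸z≡z+d+d : ∀ z d → 2 * (z + d) ∸ z ≡ z + d + d
2[z+d]∸z≡z+d+d z d = trans (cong (_∸ z) eq) (m+n∸m≡n z (z + d + d))
  where
  eq : 2 * (z + d) ≡ z + (z + d + d)
  eq = solve 2 (λ z d → (z :+ d) :+ ((z :+ d) :+ con 0) := z :+ (z :+ d :+ d)) refl z d

-- This is u + v − w ∈ P for u ≥ v ≥ w in P; the recursion on (d , k) is Euclid's algorithm.
ArfClosed⇒+-closed-above : ∀ {P} → ArfClosed P → ∀ z d k →
  z ∈ P → z + d ∈ P → z + d + k ∈ P → z + d + k + d ∈ P
ArfClosed⇒+-closed-above {P} cl = λ z d k → go z d k (<-wellFounded (d + k))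
  where
  go : ∀ z d k → Acc _<_ (d + k) → z ∈ P → z + d ∈ P → z + d + k ∈ P → z + d + k + d ∈ P
  go z zero k _ _ _ z+d+k∈ = subst P (sym (+-identityʳ _)) z+d+k∈
  go z d@(suc _) zero _ z∈ z+d∈ _ = subst P (cong (_+ d) (sym (+-identityʳ (z + d)))) (cl z d z∈ z+d∈)
  go z d@(suc _) k@(suc _) (acc rs) z∈ z+d∈ z+d+k∈ with ≤-total d k
  ... | inj₁ d≤k with m≤n⇒∃[o]m+o≡n d≤k
  ...   | l , refl = subst P (cong (_+ d) (+-assoc (z + d) d l))
          -- Here `w, v, u` become `v, 2v − w, u`. The difference `d` is kept and `k` drops to
          -- `k − d`, while `u + d` is still the target.
          (go (z + d) d l (rs (m<n+m (d + l) (s≤s z≤n))) z+d∈ (cl z d z∈ z+d∈)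
            (subst P (sym (+-assoc (z + d) d l)) z+d+k∈))
  go z d@(suc _) k@(suc _) (acc rs) z∈ z+d∈ z+d+k∈ | inj₂ k≤d with m≤n⇒∃[o]m+o≡n k≤d
  ...   | l , k+l≡d = subst P eq₂
          -- Here `w, v, u` become `v, u, 2v − w`, in this order because `k ≤ d`. The new
          -- differences `k` and `l` sum to `d`, and the target is unchanged.
          (go (z + d) k l (rs (subst (_< d + k) (sym k+l≡d) (m<m+n d (s≤s z≤n)))) z+d∈ z+d+k∈
            (subst P (sym eq₁) (cl z d z∈ z+d∈)))
    where
    eq₁ : z + d + k + l ≡ z + d + d
    eq₁ = trans (+-assoc (z + d) k l) (cong (z + d +_) k+l≡d)
    eq₂ : z + d + k + l + k ≡ z + d + k + d
    eq₂ = trans (solve 3 (λ a k l → a :+ k :+ l :+ k := a :+ k :+ (k :+ l)) refl (z + d) k l)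
                (cong (z + d + k +_) k+l≡d)

-- For `w = 0` the element `u + v − w` is a sum. So additive closure need not be checked separately
-- for the Arf sets built below.
ArfClosed⇒+-closed : ∀ {P} → 0 ∈ P → ArfClosed P → ∀ {a b} → a ∈ P → b ∈ P → a + b ∈ P
ArfClosed⇒+-closed {P} 0∈ cl {a} {b} a∈ b∈ with ≤-total a b
... | inj₁ a≤b = subst P (trans (cong (_+ a) (m+[n∸m]≡n a≤b)) (+-comm b a))
  (ArfClosed⇒+-closed-above cl 0 a (b ∸ a) 0∈ a∈ (subst P (sym (m+[n∸m]≡n a≤b)) b∈))
... | inj₂ b≤a = subst P (cong (_+ b) (m+[n∸m]≡n b≤a))
  (ArfClosed⇒+-closed-above cl 0 b (a ∸ b) 0∈ b∈ (subst P (sym (m+[n∸m]≡n b≤a)) a∈))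

ArfClosed⇒isArf : ∀ {P} → 0 ∈ P → ArfClosed P → Finite (∁ P) → IsArfNumericalSemigroup P
ArfClosed⇒isArf {P} 0∈ cl fin = record
  { isNumericalSemigroup = record
    { 0∈ = 0∈ ; +-closed = ArfClosed⇒+-closed 0∈ cl ; finiteComplement = fin }
  ; arf = arf
  }
  where
  arf : ∀ {a b} → a ∈ P → b ∈ P → b ≤ a → 2 * a ∸ b ∈ P
  arf {b = b} a∈ b∈ b≤a with m≤n⇒∃[o]m+o≡n b≤a
  ... | d , refl = subst P (sym (2[z+d]∸z≡z+d+d b d)) (cl b d b∈ a∈)

isArf⇒ArfClosed : ∀ {P} → IsArfNumericalSemigroup P → ArfClosed P
isArf⇒ArfClosed {P} isArf z d z∈ z+d∈ =
  subst P (2[z+d]∸z≡z+d+d z d) (IsArfNumericalSemigroup.arf isArf z+d∈ z∈ (m≤m+n z d))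

⟨⟩-least : ∀ {X P : SubsetOfℕ} → 0 ∈ P → (∀ {a b} → a ∈ P → b ∈ P → a + b ∈ P) → X ⊆ P → ⟨ X ⟩ ⊆ P
⟨⟩-least 0∈ +∈ X⊆P (gen m∈)   = X⊆P m∈
⟨⟩-least 0∈ +∈ X⊆P unit       = 0∈
⟨⟩-least {P = P} 0∈ +∈ X⊆P (add a∈ b∈) =
  +∈ (⟨⟩-least {P = P} 0∈ +∈ X⊆P a∈) (⟨⟩-least {P = P} 0∈ +∈ X⊆P b∈)

-- Sets given by their differences

0∈fromDifferences : ∀ {n} (x : Vec ℕ n) → 0 ∈ fromDifferences x
0∈fromDifferences x = inj₁ (zero , refl)

module _ {n : ℕ} {x₁ : ℕ} {x : Vec ℕ n} where

  fromDifferences-shift : ∀ {m} → m ∈ fromDifferences x → x₁ + m ∈ fromDifferences (x₁ ∷ x)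
  fromDifferences-shift (inj₁ (j , refl)) = inj₁ (suc j , refl)
  fromDifferences-shift (inj₂ c<m)        = inj₂ (+-monoʳ-< x₁ c<m)

  fromDifferences-uncons : ∀ {m} → m ∈ fromDifferences (x₁ ∷ x) →
    m ≡ 0 ⊎ (∃[ m′ ] m ≡ x₁ + m′ × m′ ∈ fromDifferences x)
  fromDifferences-uncons (inj₁ (zero , m≡0))   = inj₁ m≡0
  fromDifferences-uncons (inj₁ (suc j , refl)) = inj₂ (_ , refl , inj₁ (j , refl))
  fromDifferences-uncons {m} (inj₂ c<m) with m≤n⇒∃[o]m+o≡n (≤-trans (m≤m+n x₁ _) (<⇒≤ c<m))
  ... | m′ , refl = inj₂ (m′ , refl , inj₂ (+-cancelˡ-< x₁ _ m′ c<m))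

  fromDifferences-unshift : 0 < x₁ → ∀ {m} →
    x₁ + m ∈ fromDifferences (x₁ ∷ x) → m ∈ fromDifferences x
  fromDifferences-unshift 0<x₁ {m} x₁+m∈ with fromDifferences-uncons x₁+m∈
  ... | inj₁ x₁+m≡0 = ⊥-elim (n≮0 (subst (0 <_) (m+n≡0⇒m≡0 x₁ x₁+m≡0) 0<x₁))
  ... | inj₂ (m′ , eq , m′∈) = subst (fromDifferences x) (sym (+-cancelˡ-≡ x₁ m m′ eq)) m′∈

  -- The operation `2a − b` commutes with translation by `x₁`.
  fromDifferences-tail-ArfClosed : 0 < x₁ →
    ArfClosed (fromDifferences (x₁ ∷ x)) → ArfClosed (fromDifferences x)
  fromDifferences-tail-ArfClosed 0<x₁ cl z d z∈ z+d∈ =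
    fromDifferences-unshift 0<x₁ (subst (fromDifferences (x₁ ∷ x)) eq
      (cl (x₁ + z) d (fromDifferences-shift z∈)
        (subst (fromDifferences (x₁ ∷ x)) (sym (+-assoc x₁ z d)) (fromDifferences-shift z+d∈))))
    where
    eq : x₁ + z + d + d ≡ x₁ + (z + d + d)
    eq = solve 3 (λ x z d → x :+ z :+ d :+ d := x :+ (z :+ d :+ d)) refl x₁ z d

  -- As `x₁` is itself an element, so is `x₁ + m`, and `x₁` can be subtracted again. This keeps the
  -- unshifted summand available in the induction below.
  fromDifferences-⊆-tail : 0 < x₁ → ArfClosed (fromDifferences (x₁ ∷ x)) →
    fromDifferences (x₁ ∷ x) ⊆ fromDifferences x
  fromDifferences-⊆-tail 0<x₁ cl m∈ =
    fromDifferences-unshift 0<x₁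
      (ArfClosed⇒+-closed (0∈fromDifferences (x₁ ∷ x)) cl
        (subst (fromDifferences (x₁ ∷ x)) (+-identityʳ x₁) (fromDifferences-shift (0∈fromDifferences x)))
        m∈)

h-fromℕ : ∀ {n} (x : Vec ℕ n) → h x (fromℕ n) ≡ sum x
h-fromℕ []       = refl
h-fromℕ (x₁ ∷ x) = cong (x₁ +_) (h-fromℕ x)

h-suc : ∀ {n} (x : Vec ℕ n) j → h x (suc j) ≡ h x (inject₁ j) + lookup x j
h-suc (x₁ ∷ x) zero    = +-identityʳ x₁
h-suc (x₁ ∷ x) (suc j) = trans (cong (x₁ +_) (h-suc x j)) (sym (+-assoc x₁ _ _))

h-suc+sumAfter : ∀ {n} (x : Vec ℕ n) j → h x (suc j) + sumAfter x j ≡ h x (fromℕ n)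
h-suc+sumAfter (x₁ ∷ x) zero    =
  trans (cong (_+ sum x) (+-identityʳ x₁)) (cong (x₁ +_) (sym (h-fromℕ x)))
h-suc+sumAfter (x₁ ∷ x) (suc j) = trans (+-assoc x₁ _ _) (cong (x₁ +_) (h-suc+sumAfter x j))

-- Representations of the conductor plus one

1≢m+n : ∀ {m n} → 0 < m → 0 < n → m + n ≢ 1
1≢m+n 0<m 0<n m+n≡1 = <-irrefl refl (subst (2 ≤_) m+n≡1 (+-mono-≤ 0<m 0<n))

+-suc-cancelˡ : ∀ e {m c} → e + m ≡ suc (e + c) → m ≡ suc c
+-suc-cancelˡ e {m} {c} eq = +-cancelˡ-≡ e m (suc c) (trans eq (sym (+-suc e c)))

conductor+1-sum : ∀ {n} (x : Vec ℕ n) → (∀ j → 0 < lookup x j) → ArfClosed (fromDifferences x) →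
  ∀ {a b} → 0 < a → 0 < b → a ∈ fromDifferences x → b ∈ fromDifferences x →
  a + b ≡ suc (h x (fromℕ n)) → ∃[ j ] lookup x j ≡ sumAfter x j + 1
conductor+1-sum [] _ _ 0<a 0<b _ _ a+b≡1 = ⊥-elim (1≢m+n 0<a 0<b a+b≡1)
conductor+1-sum (x₁ ∷ x) pos cl {a} {b} 0<a 0<b a∈ b∈ eq
  with fromDifferences-uncons a∈ | fromDifferences-uncons b∈
... | inj₁ refl | _ = ⊥-elim (n≮0 0<a)
... | inj₂ _ | inj₁ refl = ⊥-elim (n≮0 0<b)
-- Both summands equal `x₁`, so `2x₁ = x₁ + ⋯ + xₙ + 1`, and the first index is the witness.
... | inj₂ (zero , refl , _) | inj₂ (zero , refl , _) = zero , (begin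
    x₁                     ≡⟨ +-identityʳ x₁ ⟨
    x₁ + 0                 ≡⟨ +-suc-cancelˡ x₁ (trans (cong (_+ (x₁ + 0)) (sym (+-identityʳ x₁))) eq) ⟩
    suc (h x (fromℕ _))    ≡⟨ cong suc (h-fromℕ x) ⟩
    suc (sum x)            ≡⟨ +-comm 1 (sum x) ⟩
    sum x + 1              ∎)
  where open ≡-Reasoning
-- One summand exceeds `x₁`: subtracting `x₁` from it leaves a positive element of the tail, and
-- lowers the conductor by `x₁` too.
... | inj₂ (a′@(suc _) , refl , a′∈) | _ =
  let 0<x₁ = pos zero
      j , xⱼ≡ = conductor+1-sum x (λ j → pos (suc j)) (fromDifferences-tail-ArfClosed 0<x₁ cl)
                  (s≤s z≤n) 0<b a′∈ (fromDifferences-⊆-tail 0<x₁ cl b∈)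
                  (+-suc-cancelˡ x₁ (trans (sym (+-assoc x₁ a′ b)) eq))
  in suc j , xⱼ≡
... | _ | inj₂ (b′@(suc _) , refl , b′∈) =
  let 0<x₁ = pos zero
      j , xⱼ≡ = conductor+1-sum x (λ j → pos (suc j)) (fromDifferences-tail-ArfClosed 0<x₁ cl)
                  (s≤s z≤n) 0<a b′∈ (fromDifferences-⊆-tail 0<x₁ cl a∈)
                  (+-suc-cancelˡ x₁ (trans (sym (+-assoc x₁ b′ a)) (trans (+-comm (x₁ + b′) a) eq)))
  in suc j , xⱼ≡

conductor+1-double : ∀ {n} (x : Vec ℕ n) → (∀ j → 0 < lookup x j) → ArfClosed (fromDifferences x) →
  ∀ z d → 0 < d → z ∈ fromDifferences x → z + d ∈ fromDifferences x →
  z + d + d ≡ suc (h x (fromℕ n)) → ∃[ j ] lookup x j ≡ sumAfter x j + 1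
conductor+1-double [] _ _ z d 0<d _ _ eq = ⊥-elim (1≢m+n (≤-trans 0<d (m≤n+m d z)) 0<d eq)
conductor+1-double (x₁ ∷ x) pos cl z d 0<d z∈ z+d∈ eq with fromDifferences-uncons z∈
-- Once `z = 0` there is nothing left to shift, and `d + d` is a sum of two positive elements.
... | inj₁ refl = conductor+1-sum (x₁ ∷ x) pos cl 0<d 0<d z+d∈ z+d∈ eq
... | inj₂ (z′ , refl , z′∈) =
  let 0<x₁ = pos zero
      j , xⱼ≡ = conductor+1-double x (λ j → pos (suc j)) (fromDifferences-tail-ArfClosed 0<x₁ cl)
                  z′ d 0<d z′∈
                  (fromDifferences-unshift 0<x₁
                    (subst (fromDifferences (x₁ ∷ x)) (+-assoc x₁ z′ d) z+d∈))
                  (+-suc-cancelˡ x₁ (trans eq′ eq))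
  in suc j , xⱼ≡
  where
  eq′ : x₁ + (z′ + d + d) ≡ x₁ + z′ + d + d
  eq′ = solve 3 (λ x z d → x :+ (z :+ d :+ d) := x :+ z :+ d :+ d) refl x₁ z′ d

-- Redundant and indispensable generators

_∪≥_ : SubsetOfℕ → ℕ → SubsetOfℕ
(S ∪≥ k) m = m ∈ S ⊎ k ≤ m

-- For `a ≥ b`, `2a − b ≥ a`; so as soon as `a` or `b` is at least `k`, the result is too.
∪≥-isArf : ∀ {S} k → 0 ∈ S → ArfClosed S → IsArfNumericalSemigroup (S ∪≥ k)
∪≥-isArf {S} k 0∈ cl = ArfClosed⇒isArf (inj₁ 0∈) cl′ (upTo k , below)
  where
  cl′ : ArfClosed (S ∪≥ k)
  cl′ z d (inj₁ z∈)  (inj₁ z+d∈)  = inj₁ (cl z d z∈ z+d∈)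
  cl′ z d _          (inj₂ k≤z+d) = inj₂ (≤-trans k≤z+d (m≤m+n (z + d) d))
  cl′ z d (inj₂ k≤z) (inj₁ _)     = inj₂ (≤-trans k≤z (≤-trans (m≤m+n z d) (m≤m+n (z + d) d)))
  below : ∁ (S ∪≥ k) ⊆ λ m → m List.∈ upTo k
  below {m} m∉ = ∈-upTo⁺ (≰⇒> (λ k≤m → m∉ (inj₂ k≤m)))

module _ {X H : SubsetOfℕ} (generates : IsArfSystemOfGenerators X H) where
  open IsArfSystemOfGenerators generates
  open IsArfClosure closure

  H-least : ∀ {S} → IsArfNumericalSemigroup S → X ⊆ S → H ⊆ S
  H-least {S} isArfS X⊆S = smallest S isArfS (⟨⟩-least 0∈ +-closed X⊆S)
    where open IsArfNumericalSemigroup isArfS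

  removable : ∀ z d → 0 < d → z ∈ H → z + d ∈ H →
    IsArfSystemOfGenerators (λ m → m ∈ X × m ≢ z + d + d) H
  removable z d 0<d z∈H z+d∈H = record
    { gcd≡1 = record
      { commonDivisor = λ (m∈X , _) → IsGCD.commonDivisor gcd≡1 m∈X
      ; greatest = λ {e} e∣Y → IsGCD.greatest gcd≡1
          -- Taken with `S` the multiples of `e`: if `e` divides `z` and `z + d`, it divides `d`,
          -- hence also `k`.
          (X⊆ (e ∣0)
            (λ _ _ e∣z e∣z+d → ∣m∣n⇒∣m+n e∣z+d (∣m+n∣m⇒∣n e∣z+d e∣z))
            (λ m∈X m≢ → e∣Y (m∈X , m≢)))
      }
    ; closure = record
      { isArf = isArf
      ; contains = ⟨⟩-least (IsArfNumericalSemigroup.0∈ isArf) (IsArfNumericalSemigroup.+-closed isArf)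
          (λ (m∈X , _) → contains (gen m∈X))
      ; smallest = λ S isArfS Y⊆S → H-least isArfS
          (X⊆ (IsArfNumericalSemigroup.0∈ isArfS) (isArf⇒ArfClosed isArfS)
            (λ m∈X m≢ → Y⊆S (gen (m∈X , m≢))))
      }
    }
    where
    k = z + d + d
    -- No finite complement is asked of `S`, so that the multiples of a number qualify; adjoining
    -- `[k, ∞)` supplies it.
    X⊆ : ∀ {S} → 0 ∈ S → ArfClosed S → (∀ {m} → m ∈ X → m ≢ k → m ∈ S) → X ⊆ S
    X⊆ {S} 0∈S clS Y⊆S {m} m∈X with m ≟ k
    ... | no m≢k   = Y⊆S m∈X m≢k
    ... | yes refl = clS z d (below z<k z∈H) (below z+d<k z+d∈H)
      where
      z+d<k : z + d < k
      z+d<k = m<m+n (z + d) 0<d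
      z<k : z < k
      z<k = ≤-<-trans (m≤m+n z d) z+d<k
      X⊆S∪ : X ⊆ (S ∪≥ k)
      X⊆S∪ {m} m∈X with m ≟ k
      ... | no m≢k   = inj₁ (Y⊆S m∈X m≢k)
      ... | yes refl = inj₂ ≤-refl
      below : ∀ {m} → m < k → m ∈ H → m ∈ S
      below m<k m∈H with H-least (∪≥-isArf k 0∈S clS) X⊆S∪ m∈H
      ... | inj₁ m∈S = m∈S
      ... | inj₂ k≤m = ⊥-elim (<⇒≱ m<k k≤m)

  irreducible⇒generator : ∀ {k} → 0 < k → k ∈ H →
    (∀ z d → 0 < d → z ∈ H → z + d ∈ H → z + d + d ≢ k) → k ∈ X
  irreducible⇒generator {k} 0<k k∈H irr with H-least isArfS X⊆S k∈H
    where
    open IsArfNumericalSemigroup isArf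
    S : SubsetOfℕ
    -- The implication keeps `k` exactly when `k ∈ X`, without deciding that membership.
    S m = m ∈ H × (m ≡ k → m ∈ X)
    clS : ArfClosed S
    -- For `d = 0` the result is `z + d` itself, which may be `k`; `irr` speaks only of `d > 0`.
    clS z zero    _        z+d∈S = subst S (sym (+-identityʳ (z + 0))) z+d∈S
    clS z (suc d) (z∈ , _) (z+d∈ , _) =
      isArf⇒ArfClosed isArf z (suc d) z∈ z+d∈ , λ eq → ⊥-elim (irr z (suc d) (s≤s z≤n) z∈ z+d∈ eq)
    gaps : ∁ S ⊆ λ m → m List.∈ k ∷ proj₁ finiteComplement
    gaps {m} m∉S with m ≟ k
    ... | yes m≡k = here m≡k
    ... | no m≢k  = there (proj₂ finiteComplement λ m∈H → m∉S (m∈H , λ m≡k → ⊥-elim (m≢k m≡k)))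
    isArfS : IsArfNumericalSemigroup S
    isArfS = ArfClosed⇒isArf (0∈ , λ 0≡k → ⊥-elim (<⇒≢ 0<k 0≡k)) clS (_ , gaps)
    X⊆S : X ⊆ S
    X⊆S m∈X = contains (gen m∈X) , λ _ → m∈X
  ... | _ , k∈X = k∈X refl

theorem4p4 : ∀ (H : SubsetOfℕ) → IsArfNumericalSemigroup H → H ⊂ U →
    ∀ (F : ℕ) → IsFrobeniusNumber H F →
    ∀ (n : ℕ) (x : Vec ℕ n) → (∀ j → 0 < lookup x j) →
    H ≐ fromDifferences x → h x (fromℕ n) ≡ F + 1 →
    ∀ (X : SubsetOfℕ) → IsMinimalArfSystemOfGenerators X H →
    (F + 2 ∈ X) ⇔ (∀ (j : Fin n) → lookup x j ≢ sumAfter x j + 1)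
theorem4p4 H isArf _ F _ n x pos (H⊆ , ⊆H) hₙ≡F+1 X minimalX = mk⇔ necessary sufficient
  where
  open IsMinimalArfSystemOfGenerators minimalX

  F+2≡ : F + 2 ≡ suc (h x (fromℕ n))
  F+2≡ = trans (+-suc F 1) (cong suc (sym hₙ≡F+1))

  necessary : F + 2 ∈ X → ∀ j → lookup x j ≢ sumAfter x j + 1
  necessary F+2∈X j xⱼ≡ =
    minimal Y (proj₁ , λ X⊆Y → proj₂ (X⊆Y F+2∈X) F+2≡z+d+d) (removable generates z d 0<d z∈H z+d∈H)
    where
    -- With 1-based indices, `z` is `hⱼ₋₁` and `z + d` is `hⱼ`, so `z + d + d` is `2hⱼ − hⱼ₋₁`.
    z = h x (inject₁ j)
    d = lookup x j
    Y : SubsetOfℕ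
    Y m = m ∈ X × m ≢ z + d + d
    0<d : 0 < d
    0<d = pos j
    z∈H : z ∈ H
    z∈H = ⊆H (inj₁ (inject₁ j , refl))
    z+d∈H : z + d ∈ H
    z+d∈H = ⊆H (inj₁ (suc j , sym (h-suc x j)))
    F+2≡z+d+d : F + 2 ≡ z + d + d
    F+2≡z+d+d = begin
      F + 2                               ≡⟨ F+2≡ ⟩
      suc (h x (fromℕ n))                 ≡⟨ cong suc (h-suc+sumAfter x j) ⟨
      suc (h x (suc j) + sumAfter x j)    ≡⟨ cong (λ p → suc (p + sumAfter x j)) (h-suc x j) ⟩
      suc (z + d + sumAfter x j)          ≡⟨ +-suc (z + d) (sumAfter x j) ⟨
      z + d + suc (sumAfter x j)          ≡⟨ cong (z + d +_) (+-comm 1 (sumAfter x j)) ⟩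
      z + d + (sumAfter x j + 1)          ≡⟨ cong (z + d +_) xⱼ≡ ⟨
      z + d + d                           ∎
      where open ≡-Reasoning

  closed : ArfClosed (fromDifferences x)
  closed z d z∈ z+d∈ = H⊆ (isArf⇒ArfClosed isArf z d (⊆H z∈) (⊆H z+d∈))

  sufficient : (∀ j → lookup x j ≢ sumAfter x j + 1) → F + 2 ∈ X
  sufficient x≢ = irreducible⇒generator generates
    (subst (0 <_) (sym F+2≡) (s≤s z≤n))
    -- `F + 2` is the first integer past the conductor.
    (⊆H (inj₂ (≤-reflexive (sym F+2≡))))
    λ z d 0<d z∈ z+d∈ eq →
      let j , xⱼ≡ = conductor+1-double x pos closed z d 0<d (H⊆ z∈) (H⊆ z+d∈) (trans eq F+2≡)
      in x≢ j xⱼ≡
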